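{- Let $U$ be a nonempty set, $\varphi$ an MSO formula, $x$ a first-order variable and $X$ a monadic second-order variable that does not occur free in $\varphi$. Then $$\models^{d'}\ \exists X.\,\forall x.\,(X(x)\leftrightarrow\varphi).$$
   Context: **Syntax.** Relation symbols $R=\mathbb N$, first-order variables $V=\mathbb N$ and second-order (monadic) variables $V_2=\mathbb N$ (the two kinds of variables form separate namespaces). MSO formulas: $\varphi,\psi ::= r(x,y)\mid X(x)\mid\neg\varphi\mid\varphi\wedge\psi\mid\exists x.\varphi\mid\exists X.\varphi$ with $r\in R$, $x,y\in V$, $X\in V_2$ (no equality). The connectives $\vee,\supset,\leftrightarrow$ and the universals $\forall x.\varphi:=\neg\exists x.\neg\varphi$, $\forall X.\varphi:=\neg\exists X.\neg\varphi$ are the usual abbreviations. **Semantics.** $U$ is a fixed nonempty set (the type of individuals). An interpretation $I$ over $U$ assigns to each $r\in R$ a binary relation $I(r)\subseteq U\times U$. Given $I$, $D\subseteq U$, $E\subseteq\mathcal P(U)$, $g:V\to U$, $G:V_2\to\mathcal P(U)$, truth $\langle I,D,E\rangle,g,G\models^d\varphi$ is defined recursively: $r(x,y)$ holds iff $(g(x),g(y))\in I(r)$; $X(x)$ holds iff $g(x)\in G(X)$; $\neg,\wedge$ are classical; $\exists x.\varphi$ holds iff $\langle I,D,E\rangle,g[x\leftarrow d],G\models^d\varphi$ for some $d\in D$; $\exists X.\varphi$ holds iff $\langle I,D,E\rangle,g,G\langle X\leftarrow S\rangle\models^d\varphi$ for some $S\in E$. Here $g[x\leftarrow d]$ and $G\langle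 X\leftarrow S\rangle$ are the usual updates. **Standard validity.** $\models^{d'}\varphi$ means: for all $I$, $g:V\to U$, $G:V_2\to\mathcal P(U)$, $\langle I,U,\mathcal P(U)\rangle,g,G\models^d\varphi$. -}

module Defs where

open import Level using (Level; Lift; suc)
open import Data.Nat using (ℕ; _≟_)
open import Data.Empty using (⊥)
open import Data.Product using (_×_; ∃-syntax)
open import Data.Unit.Polymorphic using (⊤)
open import Data.Sum using (_⊎_)
open import Relation.Binary.Core using (Rel)
open import Relation.Binary.PropositionalEquality using (_≡_; _≢_)
open import Relation.Nullary using (¬_; yes; no)
open import Relation.Unary using (Pred; _∈_)

R V V₂ : Set
R  = ℕ
V  = ℕ
V₂ = ℕ

infixr 6 _∧′_
infixr 5 _∨′_
infixr 4 _⊃′_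
infix  3 _↔′_
infix  7 ¬′_

data Formula : Set where
  rel  : R → V → V → Formula
  mem  : V₂ → V → Formula
  ¬′_  : Formula → Formula
  _∧′_ : Formula → Formula → Formula
  ∃′   : V → Formula → Formula
  ∃₂′  : V₂ → Formula → Formula

_∨′_ _⊃′_ _↔′_ : Formula → Formula → Formula
φ ∨′ ψ = ¬′ (¬′ φ ∧′ ¬′ ψ)
φ ⊃′ ψ = ¬′ φ ∨′ ψ
φ ↔′ ψ = (φ ⊃′ ψ) ∧′ (ψ ⊃′ φ)

∀′ : V → Formula → Formula
∀′ x φ = ¬′ ∃′ x (¬′ φ)

∀₂′ : V₂ → Formula → Formula
∀₂′ X φ = ¬′ ∃₂′ X (¬′ φ)

_FreeIn_ : V₂ → Formula → Set
X FreeIn rel r x y = ⊥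
X FreeIn mem Y x   = X ≡ Y
X FreeIn (¬′ φ)    = X FreeIn φ
X FreeIn (φ ∧′ ψ)  = X FreeIn φ ⊎ X FreeIn ψ
X FreeIn ∃′ x φ    = X FreeIn φ
X FreeIn ∃₂′ Y φ   = X ≢ Y × X FreeIn φ

private variable
  a ℓ : Level

_[_←_] : {A : Set a} → (ℕ → A) → ℕ → A → (ℕ → A)
(f [ x ← d ]) y with y ≟ x
... | yes _ = d
... | no _  = f y

-- Quantifying over 𝒫 A raises the universe level, so the truth of a formula
-- lives in Set (suc ℓ).  That { d | φ holds at d } is nevertheless (extensionally)
-- an element of 𝒫 A uses excluded middle at that level: the metatheory of the
-- semantics is classical.

𝒫 : Set ℓ → Set (suc ℓ)
𝒫 {ℓ} A = Pred A ℓ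

Interpretation : Set ℓ → Set (suc ℓ)
Interpretation {ℓ} A = R → Rel A ℓ

record Structure (A : Set ℓ) : Set (suc (suc ℓ)) where
  constructor ⟨_,_,_⟩
  field
    I : Interpretation A
    D : 𝒫 A
    E : Pred (𝒫 A) (suc ℓ)

infix 1 _,_,_⊨ᵈ_

_,_,_⊨ᵈ_ : {A : Set ℓ} → Structure A → (V → A) → (V₂ → 𝒫 A) → Formula → Set (suc ℓ)
⟨ I , D , E ⟩ , g , G ⊨ᵈ rel r x y = Lift _ (I r (g x) (g y))
⟨ I , D , E ⟩ , g , G ⊨ᵈ mem X x   = Lift _ (g x ∈ G X)
M , g , G ⊨ᵈ ¬′ φ   = ¬ (M , g , G ⊨ᵈ φ)
M , g , G ⊨ᵈ φ ∧′ ψ = (M , g , G ⊨ᵈ φ) × (M , g , G ⊨ᵈ ψ)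
M , g , G ⊨ᵈ ∃′ x φ  = ∃[ d ] d ∈ Structure.D M × (M , g [ x ← d ] , G ⊨ᵈ φ)
M , g , G ⊨ᵈ ∃₂′ X φ = ∃[ S ] S ∈ Structure.E M × (M , g , G [ X ← S ] ⊨ᵈ φ)

infix 1 _⊨ᵈ′_

_⊨ᵈ′_ : Set ℓ → Formula → Set (suc ℓ)
A ⊨ᵈ′ φ = ∀ (I : Interpretation A) (g : V → A) (G : V₂ → 𝒫 A) →
  ⟨ I , (λ _ → ⊤) , (λ _ → ⊤) ⟩ , g , G ⊨ᵈ φ

{-# OPTIONS --safe #-}

-- Take for X the set of those d at which φ holds under g [ x ← d ] and the
-- original G.  As X is not free in φ, reassigning X does not change the truth
-- of φ.  Excluded middle serves only to bring this truth value, which lives in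
-- Set (suc ℓ), down to Set ℓ.

module Submission where

open import Defs
open import Level using (Level; suc; Lift; lift; lower)
open import Axiom.ExcludedMiddle using (ExcludedMiddle)
open import Data.Nat using (ℕ; _≟_)
open import Data.Product using (_×_; _,_)
open import Data.Sum using (inj₁; inj₂)
open import Data.Unit.Polymorphic using (⊤)
open import Function using (_∘_; _$_; id; _⇔_; mk⇔; Equivalence)
open import Function.Construct.Composition using (_⇔-∘_)
open import Relation.Binary.PropositionalEquality
  using (_≡_; _≢_; refl; sym; cong₂; subst)
open import Relation.Nullary using (¬_; yes; no; contradiction)
open import Relation.Nullary.Decidable using (True; toWitness; fromWitness)
open import Relation.Unary using (_∈_)

private variable
  a ℓ : Level
  A : Set ℓ

update-same : ∀ (f : ℕ → A) n d → (f [ n ← d ]) n ≡ d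
update-same f n d with n ≟ n
... | yes _  = refl
... | no n≢n = contradiction refl n≢n

update-other : ∀ (f : ℕ → A) {m n} d → m ≢ n → (f [ n ← d ]) m ≡ f m
update-other f {m} {n} d m≢n with m ≟ n
... | yes m≡n = contradiction m≡n m≢n
... | no _    = refl

AgreeOn : Formula → (G H : V₂ → 𝒫 A) → Set _
AgreeOn φ G H = ∀ Y → Y FreeIn φ → G Y ≡ H Y

AgreeOn-sym : ∀ φ {G H : V₂ → 𝒫 A} → AgreeOn φ G H → AgreeOn φ H G
AgreeOn-sym _ G≡H Y free = sym (G≡H Y free)

-- At `X` both updates return `S`, whatever `G` and `H` assign there; a free variable of `φ` other
-- than `X` remains free in `∃₂′ X φ`, where agreement is assumed.
AgreeOn-update : ∀ {X} φ {G H : V₂ → 𝒫 A} {S} → AgreeOn (∃₂′ X φ) G H →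
  AgreeOn φ (G [ X ← S ]) (H [ X ← S ])
AgreeOn-update {X = X} φ G≡H Y free with Y ≟ X
... | yes _  = refl
... | no Y≢X = G≡H Y (Y≢X , free)

-- Induction on `φ` with `G` and `H` varying: negation reverses the implication, so the two swap
-- roles there, and a second-order quantifier updates both with the same witness `S`.
coincidence : ∀ {M : Structure A} {g} {G H : V₂ → 𝒫 A} φ → AgreeOn φ G H →
  (M , g , G ⊨ᵈ φ) → (M , g , H ⊨ᵈ φ)
coincidence (rel r x y) G≡H p = p
coincidence {g = g} (mem X x) G≡H (lift p) = lift (subst (g x ∈_) (G≡H X refl) p)
coincidence (¬′ φ) G≡H ¬p = ¬p ∘ coincidence φ (AgreeOn-sym φ G≡H)
coincidence (φ ∧′ ψ) G≡H (p , q) =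
  coincidence φ (λ Y → G≡H Y ∘ inj₁) p , coincidence ψ (λ Y → G≡H Y ∘ inj₂) q
coincidence (∃′ x φ) G≡H (d , d∈D , p) = d , d∈D , coincidence φ G≡H p
coincidence (∃₂′ X φ) G≡H (S , S∈E , p) =
  S , S∈E , coincidence φ (AgreeOn-update φ G≡H) p

⊨-update-fresh : ∀ {M : Structure A} {g} {G : V₂ → 𝒫 A} {X S} φ → ¬ (X FreeIn φ) →
  (M , g , G ⊨ᵈ φ) ⇔ (M , g , G [ X ← S ] ⊨ᵈ φ)
⊨-update-fresh {G = G} {X} {S} φ fresh =
  mk⇔ (coincidence φ (AgreeOn-sym φ agree)) (coincidence φ agree)
  where
  agree : AgreeOn φ (G [ X ← S ]) G
  agree Y free = update-other G S λ { refl → fresh free }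

⊨-mem-update : ∀ (M : Structure A) g (G : V₂ → 𝒫 A) X S x d →
  (M , g [ x ← d ] , G [ X ← S ] ⊨ᵈ mem X x) ⇔ d ∈ S
⊨-mem-update _ g G X S x d =
  mk⇔ (subst id eq ∘ lower) (lift ∘ subst id (sym eq))
  where
  eq : (G [ X ← S ]) X ((g [ x ← d ]) x) ≡ S d
  eq = cong₂ (_$_) (update-same G X S) (update-same g x d)

⊨-↔ : ∀ {M : Structure A} {g} {G : V₂ → 𝒫 A} φ ψ →
  (M , g , G ⊨ᵈ φ) ⇔ (M , g , G ⊨ᵈ ψ) → M , g , G ⊨ᵈ φ ↔′ ψ
⊨-↔ φ ψ p⇔q =
  implies (Equivalence.to p⇔q) , implies (Equivalence.from p⇔q)
  where
  -- `¬ (¬ ¬ P × ¬ Q)` is what the truth of an implication `⊃′` unfolds to; deriving it from `P → Q`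
  -- is constructive.
  implies : ∀ {P Q : Set _} → (P → Q) → ¬ (¬ ¬ P × ¬ Q)
  implies f (¬¬p , ¬q) = ¬¬p (¬q ∘ f)

module _ (em : ExcludedMiddle a) where

  -- `True` of a decision is the unit or the empty type in the lowest universe, so it can be lifted
  -- to any level.
  resize : Set a → Set ℓ
  resize P = Lift _ (True (em {P}))

  resize-⇔ : ∀ {P} → resize {ℓ} P ⇔ P
  resize-⇔ = mk⇔ (toWitness ∘ lower) (lift ∘ fromWitness)

mainTheorem7 : ∀ {ℓ : Level} → ExcludedMiddle (suc ℓ) →
    ∀ (U : Set ℓ) → U → ∀ (φ : Formula) (x : V) (X : V₂) → ¬ (X FreeIn φ) →
    U ⊨ᵈ′ ∃₂′ X (∀′ x (mem X x ↔′ φ))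
mainTheorem7 em U _ φ x X fresh I g G =
  -- Every set lies in the full `𝒫 U`, so `_` is trivial. As `∀′` is `¬∃¬`, what remains is to
  -- refute a `d` at which the biconditional fails.
  S , _ , λ { (d , _ , ¬iff) → ¬iff (⊨-↔ (mem X x) φ
    -- Read from right to left: `X(x)` after the updates, `d ∈ S`, `φ` under `G`, `φ` under
    -- `G [ X ← S ]`.
    (⊨-update-fresh φ fresh ⇔-∘ (resize-⇔ em ⇔-∘ ⊨-mem-update M g G X S x d))) }
  where
  M : Structure U
  M = ⟨ I , (λ _ → ⊤) , (λ _ → ⊤) ⟩

  S : 𝒫 U
  S d = resize em (M , g [ x ← d ] , G ⊨ᵈ φ)
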